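{- Consider scheduling weighted jobs in the $\delta$-commitment model. For any $\delta>0$ and any $\varepsilon$ with $\delta\le\varepsilon<1+\delta$, no deterministic online algorithm has a bounded competitive ratio for weighted throughput on instances with $\varepsilon$-slack; that is, for no finite $c$ is there a deterministic $c$-competitive online algorithm.
   Context: Jobs arrive online over time on a single machine. Job $j$ has release date $r_j$, processing time $p_j\ge 0$, deadline $d_j$ and weight $w_j>0$; it becomes known to an online algorithm at time $r_j$. To complete on time, $j$ must receive a total of $p_j$ units of processing within $[r_j,d_j]$; preemption is allowed. An instance is a finite set of jobs; it has $\varepsilon$-slack if $d_j-r_j\ge(1+\varepsilon)p_j$ for every job $j$. The objective is the weighted throughput, i.e. the total weight of jobs completed on time. $\delta$-commitment model: the algorithm must commit to completing a job $j$ no later than time $d_j-(1+\delta)p_j$ (jobs not committed to by then are discarded and do not contribute to the objective); it may process jobs before committing to them; every job it commits to must be completed on time. An online algorithm is $c$-competitive if for every instance with $\varepsilon$-slack the weighted throughput of an optimal offline schedule (which knows the whole instance) is at most $c$ times the algorithm's weighted throughput. -}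

module Defs where

open import Level using (Level; _⊔_) renaming (suc to lsuc)
open import Algebra.Bundles using (CommutativeRing)
open import Algebra.Bundles.Raw using (RawMonoid)
open import Algebra.Structures using (IsCommutativeRing)
import Algebra.Construct.NaturalChoice.Max as Max
import Algebra.Construct.NaturalChoice.Min as Min
import Algebra.Definitions.RawMonoid as Multiples
open import Data.List.Base using (List; map; foldr; filter; filterᵇ)
open import Data.List.Membership.Propositional using (_∈_)
open import Data.List.Relation.Unary.All using (All)
open import Data.List.Relation.Unary.Any using (Any)
open import Data.List.Relation.Unary.AllPairs using (AllPairs)
open import Data.List.Relation.Unary.Unique.Propositional using (Unique)
open import Data.Maybe.Base using (Maybe; just; is-just)
open import Data.Nat.Base using (ℕ)
import Data.Nat.Properties as ℕ
open import Data.Product.Base using (_×_; _,_; ∃-syntax)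
open import Data.Sum.Base using (_⊎_)
open import Function.Bundles using (_⇔_)
open import Relation.Binary.Bundles using (DecTotalOrder)
open import Relation.Binary.Core using (Rel)
open import Relation.Binary.Definitions using (DecidableEquality)
import Relation.Binary.Construct.NonStrictToStrict as Strict
open import Relation.Binary.PropositionalEquality using (_≡_; _≢_; refl)
open import Relation.Binary.Structures using (IsDecTotalOrder)
open import Relation.Nullary.Decidable using (Dec; map′; _×-dec_)

-- Times and weights live in an arbitrary Archimedean ordered field; the real
-- numbers (with classical logic) and the rational numbers are instances.

record ArchimedeanOrderedField (a ℓ : Level) : Set (lsuc (a ⊔ ℓ)) where
  infix  8 -_
  infixl 7 _*_
  infixl 6 _+_
  infix  4 _≤_
  field
    Carrier           : Set a
    _≤_               : Rel Carrier ℓ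
    _+_ _*_           : Carrier → Carrier → Carrier
    -_                : Carrier → Carrier
    0# 1#             : Carrier
    isCommutativeRing : IsCommutativeRing _≡_ _+_ _*_ -_ 0# 1#
    isDecTotalOrder   : IsDecTotalOrder _≡_ _≤_
    0≢1               : 0# ≢ 1#
    inverse           : ∀ x → x ≢ 0# → ∃[ y ] x * y ≡ 1#
    +-monoˡ-≤         : ∀ z {x y} → x ≤ y → x + z ≤ y + z
    *-nonNeg          : ∀ {x y} → 0# ≤ x → 0# ≤ y → 0# ≤ x * y

  +-rawMonoid : RawMonoid a a
  +-rawMonoid = record { Carrier = Carrier ; _≈_ = _≡_ ; _∙_ = _+_ ; ε = 0# }

  open Multiples +-rawMonoid using () renaming (_×_ to _·_)

  field
    archimedean : ∀ x → ∃[ n ] x ≤ n · 1#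

  commutativeRing : CommutativeRing a a
  commutativeRing = record { isCommutativeRing = isCommutativeRing }

  decTotalOrder : DecTotalOrder a a ℓ
  decTotalOrder = record { isDecTotalOrder = isDecTotalOrder }

  open CommutativeRing commutativeRing public using (_-_)
  open DecTotalOrder decTotalOrder public using (_≟_; _≤?_; totalOrder)
  open Strict _≡_ _≤_ public using (_<_)
  open Max totalOrder public using () renaming (_⊔_ to max)
  open Min totalOrder public using () renaming (_⊓_ to min)

module Scheduling {a ℓ} (F : ArchimedeanOrderedField a ℓ) where

  open ArchimedeanOrderedField F

  -- The label carries no scheduling information; it allows an instance to
  -- contain several jobs with the same parameters.

  record Job : Set a where
    constructor mkJob
    field
      label      : ℕ
      release    : Carrier
      processing : Carrier
      deadline   : Carrier
      weight     : Carrier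

  open Job public

  _≟ᴶ_ : DecidableEquality Job
  mkJob l r p d w ≟ᴶ mkJob l′ r′ p′ d′ w′ =
    map′ (λ { (refl , refl , refl , refl , refl) → refl })
         (λ { refl → refl , refl , refl , refl , refl })
         (l ℕ.≟ l′ ×-dec r ≟ r′ ×-dec p ≟ p′ ×-dec d ≟ d′ ×-dec w ≟ w′)

  record Instance : Set (a ⊔ ℓ) where
    field
      jobs              : List Job
      distinct          : Unique jobs
      processing-nonNeg : All (λ j → 0# ≤ processing j) jobs
      weight-pos        : All (λ j → 0# < weight j) jobs

  open Instance public

  HasSlack : Carrier → Instance → Set (a ⊔ ℓ)
  HasSlack ε I =
    All (λ j → (1# + ε) * processing j ≤ deadline j - release j) (jobs I)

  sum : List Carrier → Carrier
  sum = foldr _+_ 0#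

  -- The machine works on `job` during the half-open interval [start, stop).

  record Segment : Set a where
    constructor mkSegment
    field
      job   : Job
      start : Carrier
      stop  : Carrier

  open Segment public

  -- The order of the segments in the list is irrelevant.

  Schedule : Set a
  Schedule = List Segment

  Disjoint : Rel Segment ℓ
  Disjoint s s′ = stop s ≤ start s′ ⊎ stop s′ ≤ start s

  record IsScheduleFor (I : Instance) (S : Schedule) : Set (a ⊔ ℓ) where
    field
      known         : All (λ s → job s ∈ jobs I) S
      after-release : All (λ s → release (job s) ≤ start s) S
      nonempty      : All (λ s → start s < stop s) S
      one-machine   : AllPairs Disjoint S

  timeWithin : Carrier → Carrier → Segment → Carrier
  timeWithin x y s = max 0# (min (stop s) y - max (start s) x)

  processed : Schedule → Job → Carrier → Carrier → Carrier
  processed S j x y =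
    sum (map (timeWithin x y) (filter (λ s → job s ≟ᴶ j) S))

  CompletedOnTime : Schedule → Job → Set ℓ
  CompletedOnTime S j = processing j ≤ processed S j (release j) (deadline j)

  completedOnTime? : ∀ S j → Dec (CompletedOnTime S j)
  completedOnTime? S j = processing j ≤? processed S j (release j) (deadline j)

  throughput : List Job → Schedule → Carrier
  throughput js S = sum (map weight (filter (completedOnTime? S) js))

  IsOptimal : Instance → Schedule → Set (a ⊔ ℓ)
  IsOptimal I S =
    IsScheduleFor I S ×
    (∀ S′ → IsScheduleFor I S′ → throughput (jobs I) S′ ≤ throughput (jobs I) S)

  -- `commitment j ≡ just t` : the algorithm commits to job j at time t.
  -- `commitment j ≡ nothing` : job j is discarded.

  record Outcome : Set a where
    field
      schedule   : Schedule
      commitment : Job → Maybe Carrier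

  open Outcome public

  value : Instance → Outcome → Carrier
  value I O =
    throughput (filterᵇ (λ j → is-just (commitment O j)) (jobs I)) (schedule O)

  Runs : Schedule → Job → Carrier → Set (a ⊔ ℓ)
  Runs S j t = Any (λ s → job s ≡ j × start s ≤ t × t < stop s) S

  SameReleasedBy : Carrier → Instance → Instance → Set (a ⊔ ℓ)
  SameReleasedBy t I I′ =
    ∀ j → release j ≤ t → (j ∈ jobs I ⇔ j ∈ jobs I′)

  SameDecisionsUpTo : Carrier → Outcome → Outcome → Set (a ⊔ ℓ)
  SameDecisionsUpTo t O O′ = ∀ u → u ≤ t → ∀ j →
    (Runs (schedule O) j u ⇔ Runs (schedule O′) j u) ×
    (commitment O j ≡ just u ⇔ commitment O′ j ≡ just u)

  record RespectsCommitment (δ : Carrier) (I : Instance) (O : Outcome)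
         : Set (a ⊔ ℓ) where
    field
      isSchedule : IsScheduleFor I (schedule O)
      committed  : ∀ j t → commitment O j ≡ just t →
        j ∈ jobs I ×
        release j ≤ t ×
        t ≤ deadline j - (1# + δ) * processing j ×
        CompletedOnTime (schedule O) j

  -- A deterministic online algorithm is a function from instances to outcomes
  -- whose decisions up to time t depend only on the jobs released by time t.

  record OnlineAlgorithm (δ ε : Carrier) : Set (a ⊔ ℓ) where
    field
      run         : Instance → Outcome
      online      : ∀ I I′ → HasSlack ε I → HasSlack ε I′ →
                    ∀ t → SameReleasedBy t I I′ →
                    SameDecisionsUpTo t (run I) (run I′)
      commitments : ∀ I → HasSlack ε I → RespectsCommitment δ I (run I)

  open OnlineAlgorithm public

  Competitive : ∀ {δ ε} → Carrier → OnlineAlgorithm δ ε → Set (a ⊔ ℓ)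
  Competitive {ε = ε} c A = ∀ I → HasSlack ε I → ∀ S → IsOptimal I S →
    throughput (jobs I) S ≤ c * value I (run A I)

{-# OPTIONS --safe #-}

-- All jobs share the deadline κ = 1 + ε and are tight, and each is worth more
-- than c times its predecessors together, so a c-competitive algorithm commits
-- to every job that is, at the moment, the last one.  The next job arrives just
-- after the deadline for that commitment, too late to revoke it.  If its
-- processing time satisfies κ p(n+1) = (ε + η) p(n) with 0 < η and ε + η < 1 + δ,
-- then (1 − η) P(n) + κ p(n) = κ, where P(n) = p(0) + … + p(n−1).  All committed
-- jobs are completed in [0, κ], so P(n) ≤ κ; hence κ p(n) ≥ η κ for all n, and
-- P(n) grows beyond all bounds, a contradiction.

module Submission where

open import Level using (Level)
open import Algebra.Bundles using (CommutativeRing)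
import Algebra.Construct.NaturalChoice.Max as Max
import Algebra.Construct.NaturalChoice.Min as Min
import Algebra.Definitions.RawMonoid as Multiples
import Algebra.Properties.Semiring.Mult
import Algebra.Solver.Ring
open import Algebra.Solver.Ring.AlmostCommutativeRing
  using (_-Raw-AlmostCommutative⟶_; fromCommutativeRing)
open import Data.Bool.Base using (T)
open import Data.Empty using (⊥; ⊥-elim)
open import Data.Integer.Base as ℤ using (ℤ; +_; -[1+_])
import Data.Integer.Properties as ℤ
open import Data.List.Base
  using (List; []; _∷_; _++_; map; filter; filterᵇ; applyDownFrom)
open import Data.List.Membership.Propositional using (_∈_)
open import Data.List.Membership.Propositional.Properties
  using (∈-map⁺; ∈-++⁺ˡ; ∈-++⁺ʳ; ∈-filter⁺; ∈-applyDownFrom⁺; ∈-applyDownFrom⁻)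
open import Data.List.Properties using (filter-accept; filter-reject)
open import Data.List.Relation.Unary.All as All using (All; []; _∷_)
import Data.List.Relation.Unary.All.Properties as All
open import Data.List.Relation.Unary.AllPairs using (AllPairs; []; _∷_)
open import Data.List.Relation.Unary.Any using (here; there)
open import Data.List.Relation.Unary.Unique.Propositional using (Unique)
open import Data.List.Relation.Unary.Unique.Propositional.Properties
  using (applyDownFrom⁺₁)
open import Data.Maybe.Base using (Maybe; just; nothing; is-just)
import Data.Maybe.Base as Maybe
open import Data.Nat.Base as ℕ using (ℕ; zero; suc)
import Data.Nat.Properties as ℕₚ
open import Data.Product.Base using (Σ; ∃-syntax; _×_; _,_; proj₁; proj₂)
import Data.Sign.Base as Sign
open import Data.Sum.Base using (inj₁; inj₂)
open import Function.Base using (_∘_; _$_; case_of_)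
open import Function.Bundles using (mk⇔; Equivalence)
open import Relation.Binary.Bundles using (DecTotalOrder)
import Relation.Binary.Construct.NonStrictToStrict as Strict
open import Relation.Binary.Consequences using (dec⇒weaklyDec)
open import Relation.Binary.PropositionalEquality as ≡
  using (_≡_; _≢_; refl; sym; trans; cong; subst; subst₂)
import Relation.Binary.Reasoning.PartialOrder
open import Relation.Nullary using (¬_; T?; yes; no; ¬¬-excluded-middle)
open import Relation.Unary using (Decidable)
open import Defs

-- The ring solver with coefficients in the ring itself cannot cancel x - x, as
-- the abstract 1# - 1# does not compute; integer coefficients do.

module IntegerCoefficients {c ℓ} (R : CommutativeRing c ℓ) where
  open CommutativeRing R renaming (refl to ≈-refl; sym to ≈-sym; trans to ≈-trans)
  open import Algebra.Properties.Ring ring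
  open import Algebra.Properties.AbelianGroup +-abelianGroup using (⁻¹-∙-comm)
  open import Algebra.Properties.Semiring.Mult.TCOptimised semiring renaming (_×_ to _·_)
  open import Relation.Binary.Reasoning.Setoid setoid

  private
    -- The optimised multiple makes `1 · 1#` definitionally `1#`, so that `con (+ 1)` in a solver
    -- equation evaluates to a plain `1#`.
    ℕ⟦_⟧ : ℕ → Carrier
    ℕ⟦ n ⟧ = n · 1#

    ℤ⟦_⟧ : ℤ → Carrier
    ℤ⟦ + n      ⟧ = ℕ⟦ n ⟧
    ℤ⟦ -[1+ n ] ⟧ = - ℕ⟦ suc n ⟧

    -‿homo : ∀ i → ℤ⟦ ℤ.- i ⟧ ≈ - ℤ⟦ i ⟧
    -‿homo (+ zero)   = ≈-sym -0#≈0#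
    -‿homo (+ suc n)  = ≈-refl
    -‿homo -[1+ n ]   = ≈-sym (-‿involutive _)

    ⊖-homo : ∀ m n → ℤ⟦ m ℤ.⊖ n ⟧ ≈ ℕ⟦ m ⟧ - ℕ⟦ n ⟧
    ⊖-homo zero    zero    = ≈-sym (-‿inverseʳ 0#)
    ⊖-homo zero    (suc n) = ≈-sym (+-identityˡ _)
    ⊖-homo (suc m) zero    = ≈-sym (≈-trans (+-congˡ -0#≈0#) (+-identityʳ _))
    ⊖-homo (suc m) (suc n) = begin
      ℤ⟦ suc m ℤ.⊖ suc n ⟧                  ≡⟨ ≡.cong ℤ⟦_⟧ (ℤ.[1+m]⊖[1+n]≡m⊖n m n) ⟩
      ℤ⟦ m ℤ.⊖ n ⟧                          ≈⟨ ⊖-homo m n ⟩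
      ℕ⟦ m ⟧ - ℕ⟦ n ⟧                       ≈⟨ +-congʳ (+-identityʳ _) ⟨
      -- The unit that both `suc`s share is inserted here as `1# - 1#` and then distributed.
      ℕ⟦ m ⟧ + 0# - ℕ⟦ n ⟧                  ≈⟨ +-congʳ (+-congˡ (-‿inverseʳ 1#)) ⟨
      ℕ⟦ m ⟧ + (1# - 1#) - ℕ⟦ n ⟧           ≈⟨ +-congʳ (+-assoc _ _ _) ⟨
      ℕ⟦ m ⟧ + 1# - 1# - ℕ⟦ n ⟧             ≈⟨ +-assoc _ _ _ ⟩
      ℕ⟦ m ⟧ + 1# + (- 1# - ℕ⟦ n ⟧)         ≈⟨ +-cong (+-comm _ _) (⁻¹-∙-comm _ _) ⟩
      1# + ℕ⟦ m ⟧ - (1# + ℕ⟦ n ⟧)           ≈⟨ +-cong (×-homo-+ 1# 1 m) (-‿cong (×-homo-+ 1# 1 n)) ⟨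
      ℕ⟦ suc m ⟧ - ℕ⟦ suc n ⟧               ∎

    +-homo : ∀ i j → ℤ⟦ i ℤ.+ j ⟧ ≈ ℤ⟦ i ⟧ + ℤ⟦ j ⟧
    +-homo (+ m)    (+ n)    = ×-homo-+ 1# m n
    +-homo (+ m)    -[1+ n ] = ⊖-homo m (suc n)
    +-homo -[1+ m ] (+ n)    = ≈-trans (⊖-homo n (suc m)) (+-comm _ _)
    +-homo -[1+ m ] -[1+ n ] = begin
      - ℕ⟦ suc (suc (m ℕ.+ n)) ⟧     ≡⟨ ≡.cong (λ k → - ℕ⟦ suc k ⟧) (ℕₚ.+-suc m n) ⟨
      - ℕ⟦ suc m ℕ.+ suc n ⟧         ≈⟨ -‿cong (×-homo-+ 1# (suc m) (suc n)) ⟩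
      - (ℕ⟦ suc m ⟧ + ℕ⟦ suc n ⟧)    ≈⟨ ⁻¹-∙-comm _ _ ⟨
      - ℕ⟦ suc m ⟧ - ℕ⟦ suc n ⟧      ∎

    -◃-homo : ∀ n → ℤ⟦ Sign.- ℤ.◃ n ⟧ ≈ - ℕ⟦ n ⟧
    -◃-homo n = ≈-trans (reflexive (≡.cong ℤ⟦_⟧ (ℤ.-◃n≡-n n))) (-‿homo (+ n))

    *-homo : ∀ i j → ℤ⟦ i ℤ.* j ⟧ ≈ ℤ⟦ i ⟧ * ℤ⟦ j ⟧
    *-homo (+ m)    (+ n)    = ≈-trans (reflexive (≡.cong ℤ⟦_⟧ (ℤ.+◃n≡+n (m ℕ.* n)))) (×1-homo-* m n)
    *-homo (+ m)    -[1+ n ] = ≈-trans (-◃-homo (m ℕ.* suc n))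
      (≈-trans (-‿cong (×1-homo-* m (suc n))) (-‿distribʳ-* _ _))
    *-homo -[1+ m ] (+ n)    = ≈-trans (-◃-homo (suc m ℕ.* n))
      (≈-trans (-‿cong (×1-homo-* (suc m) n)) (-‿distribˡ-* _ _))
    *-homo -[1+ m ] -[1+ n ] = begin
      ℕ⟦ suc m ℕ.* suc n ⟧              ≈⟨ ×1-homo-* (suc m) (suc n) ⟩
      ℕ⟦ suc m ⟧ * ℕ⟦ suc n ⟧           ≈⟨ -‿involutive _ ⟨
      - - (ℕ⟦ suc m ⟧ * ℕ⟦ suc n ⟧)     ≈⟨ -‿cong (-‿distribˡ-* _ _) ⟩
      - (- ℕ⟦ suc m ⟧ * ℕ⟦ suc n ⟧)     ≈⟨ -‿distribʳ-* _ _ ⟩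
      - ℕ⟦ suc m ⟧ * - ℕ⟦ suc n ⟧       ∎

    homomorphism : CommutativeRing.rawRing ℤ.+-*-commutativeRing
                   -Raw-AlmostCommutative⟶ fromCommutativeRing R
    homomorphism = record
      { ⟦_⟧    = ℤ⟦_⟧
      ; +-homo = +-homo
      ; *-homo = *-homo
      ; -‿homo = -‿homo
      ; 0-homo = ≈-refl
      ; 1-homo = ≈-refl
      }

    _≟_ : ∀ i j → Maybe (ℤ⟦ i ⟧ ≈ ℤ⟦ j ⟧)
    i ≟ j = Maybe.map (λ i≡j → reflexive (≡.cong ℤ⟦_⟧ i≡j)) (dec⇒weaklyDec ℤ._≟_ i j)

  open Algebra.Solver.Ring _ _ homomorphism _≟_ public

-- Inequalities in an Archimedean ordered field

module OrderedField {a ℓ} (F : ArchimedeanOrderedField a ℓ) where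
  open ArchimedeanOrderedField F
  open CommutativeRing commutativeRing
    using (semiring; +-identityˡ; +-identityʳ; +-comm; *-identityˡ; *-comm; zeroʳ; -‿inverseʳ)
  open IntegerCoefficients commutativeRing using (solve; _:+_; _:*_; _:-_; :-_; con; _:=_)
  open DecTotalOrder decTotalOrder using (poset)
    renaming (refl to ≤-refl; reflexive to ≤-reflexive; trans to ≤-trans;
              antisym to ≤-antisym; total to ≤-total)
  open Relation.Binary.Reasoning.PartialOrder poset
  open Multiples +-rawMonoid using () renaming (_×_ to _·_)

  <⇒≱ : ∀ {x y} → x < y → ¬ (y ≤ x)
  <⇒≱ = Strict.<⇒≱ _≡_ _≤_ ≤-antisym

  <⇒≤ : ∀ {x y} → x < y → x ≤ y
  <⇒≤ = proj₁

  x≤y⇒0≤y-x : ∀ {x y} → x ≤ y → 0# ≤ y - x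
  x≤y⇒0≤y-x {x} {y} x≤y = subst (_≤ y - x) (-‿inverseʳ x) (+-monoˡ-≤ (- x) x≤y)

  0≤y-x⇒x≤y : ∀ {x y} → 0# ≤ y - x → x ≤ y
  0≤y-x⇒x≤y {x} {y} 0≤y-x = subst₂ _≤_ (+-identityˡ x)
    (solve 2 (λ x y → y :- x :+ x := y) refl x y) (+-monoˡ-≤ x 0≤y-x)

  +-mono-≤ : ∀ {x y u v} → x ≤ y → u ≤ v → x + u ≤ y + v
  +-mono-≤ {x} {y} {u} {v} x≤y u≤v = begin
    x + u  ≤⟨ +-monoˡ-≤ u x≤y ⟩
    y + u  ≡⟨ +-comm y u ⟩
    u + y  ≤⟨ +-monoˡ-≤ y u≤v ⟩
    v + y  ≡⟨ +-comm v y ⟩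
    y + v  ∎

  neg-mono-≤ : ∀ {x y} → x ≤ y → - y ≤ - x
  neg-mono-≤ {x} {y} x≤y = 0≤y-x⇒x≤y $ subst (0# ≤_)
    (solve 2 (λ x y → y :- x := :- x :- :- y) refl x y) (x≤y⇒0≤y-x x≤y)

  0≤y⇒x≤x+y : ∀ {x y} → 0# ≤ y → x ≤ x + y
  0≤y⇒x≤x+y {x} {y} 0≤y = subst (_≤ x + y) (+-identityʳ x) (+-mono-≤ ≤-refl 0≤y)

  *-monoˡ-≤ : ∀ {x y z} → 0# ≤ z → x ≤ y → z * x ≤ z * y
  *-monoˡ-≤ {x} {y} {z} 0≤z x≤y = 0≤y-x⇒x≤y $ subst (0# ≤_)
    (solve 3 (λ x y z → z :* (y :- x) := z :* y :- z :* x) refl x y z)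
    (*-nonNeg 0≤z (x≤y⇒0≤y-x x≤y))

  *-monoʳ-≤ : ∀ {x y z} → 0# ≤ z → x ≤ y → x * z ≤ y * z
  *-monoʳ-≤ {x} {y} {z} 0≤z x≤y =
    subst₂ _≤_ (*-comm z x) (*-comm z y) (*-monoˡ-≤ 0≤z x≤y)

  -- If `1# ≤ 0#`, then `- 1#` is non-negative, and so is its square, which is `1#`.
  0<1 : 0# < 1#
  0<1 with ≤-total 0# 1#
  ... | inj₁ 0≤1 = 0≤1 , 0≢1
  ... | inj₂ 1≤0 = subst (0# ≤_)
    (solve 0 (:- con (+ 1) :* :- con (+ 1) := con (+ 1)) refl) (*-nonNeg 0≤-1 0≤-1) , 0≢1
    where
    0≤-1 : 0# ≤ - 1#
    0≤-1 = subst (_≤ - 1#) (solve 0 (:- con (+ 0) := con (+ 0)) refl) (neg-mono-≤ 1≤0)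

  pos+nonNeg : ∀ {x y} → 0# < x → 0# ≤ y → 0# < x + y
  pos+nonNeg {x} {y} 0<x 0≤y = begin-strict
    0#      <⟨ 0<x ⟩
    x       ≤⟨ 0≤y⇒x≤x+y 0≤y ⟩
    x + y   ∎

  x<y⇒0<y-x : ∀ {x y} → x < y → 0# < y - x
  x<y⇒0<y-x {x} {y} (x≤y , x≢y) = x≤y⇒0≤y-x x≤y , λ 0≡y-x → x≢y $ begin-equality
    x            ≡⟨ +-identityˡ x ⟨
    0# + x       ≡⟨ cong (_+ x) 0≡y-x ⟩
    y - x + x    ≡⟨ solve 2 (λ x y → y :- x :+ x := y) refl x y ⟩
    y            ∎

  0<y-x⇒x<y : ∀ {x y} → 0# < y - x → x < y
  0<y-x⇒x<y {x} (0≤y-x , 0≢y-x) =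
    0≤y-x⇒x≤y 0≤y-x , λ { refl → 0≢y-x (sym (-‿inverseʳ x)) }

  *-pos : ∀ {x y} → 0# < x → 0# < y → 0# < x * y
  *-pos {x} {y} (0≤x , 0≢x) (0≤y , 0≢y) = *-nonNeg 0≤x 0≤y , λ 0≡xy → 0≢y $ begin-equality
    0#               ≡⟨ zeroʳ x⁻¹ ⟨
    x⁻¹ * 0#         ≡⟨ cong (x⁻¹ *_) 0≡xy ⟩
    x⁻¹ * (x * y)    ≡⟨ solve 3 (λ i x y → i :* (x :* y) := (x :* i) :* y) refl x⁻¹ x y ⟩
    (x * x⁻¹) * y    ≡⟨ cong (_* y) (proj₂ x-inverse) ⟩
    1# * y           ≡⟨ *-identityˡ y ⟩
    y                ∎
    where
    x-inverse = inverse x (0≢x ∘ sym)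
    x⁻¹ = proj₁ x-inverse

  -- An inverse `y ≤ 0#` would give `1# ≡ x * y ≤ 0#`.
  pos-inverse : ∀ {x} → 0# < x → ∃[ y ] (0# < y × x * y ≡ 1#)
  pos-inverse {x} (0≤x , 0≢x) with inverse x (0≢x ∘ sym)
  ... | y , xy≡1 with ≤-total 0# y
  ...   | inj₁ 0≤y = y , (0≤y , λ { refl → 0≢1 (trans (sym (zeroʳ x)) xy≡1) }) , xy≡1
  ...   | inj₂ y≤0 = ⊥-elim $ <⇒≱ 0<1 $ begin
    1#        ≡⟨ xy≡1 ⟨
    x * y     ≤⟨ *-monoˡ-≤ 0≤x y≤0 ⟩
    x * 0#    ≡⟨ zeroʳ x ⟩
    0#        ∎

  -- Scaling by the inverse of `x` reduces the claim to multiples of `1#`. The Archimedean bound is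
  -- taken at `z * x⁻¹ + 1#`, as the surplus `1#` yields the contradiction `1# ≤ 0#`.
  multiples-unbounded : ∀ {x z} → 0# < x → ¬ (∀ n → n · x ≤ z)
  multiples-unbounded {x} {z} 0<x bounded
    with x⁻¹ , 0<x⁻¹ , xx⁻¹≡1 ← pos-inverse 0<x
    with n , large ← archimedean (z * x⁻¹ + 1#) = <⇒≱ 0<1 $ 0≤y-x⇒x≤y $ begin
      0#                         ≤⟨ x≤y⇒0≤y-x $ begin
        z * x⁻¹ + 1#    ≤⟨ large ⟩
        n · 1#          ≡⟨ cong (n ·_) xx⁻¹≡1 ⟨
        n · (x * x⁻¹)   ≡⟨ Algebra.Properties.Semiring.Mult.×-assoc-* semiring n x x⁻¹ ⟨
        n · x * x⁻¹     ≤⟨ *-monoʳ-≤ (<⇒≤ 0<x⁻¹) (bounded n) ⟩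
        z * x⁻¹         ∎ ⟩
      z * x⁻¹ - (z * x⁻¹ + 1#)
        ≡⟨ solve 1 (λ v → v :- (v :+ con (+ 1)) := con (+ 0) :- con (+ 1)) refl (z * x⁻¹) ⟩
      0# - 1# ∎

  -- Which of the values are attained is undecidable, hence the double negation.

  ¬¬-maximum : ∀ {x} {X : Set x} (f : X → Carrier) (vs : List Carrier) →
               (∀ x → f x ∈ vs) → X → ¬ ¬ (∃[ m ] ∀ x → f x ≤ f m)
  ¬¬-maximum {X = X} f vs range x₀ ¬max = restricted vs λ (m , ub) → ¬max (m , λ x → ub x (range x))
    where
    -- Only arguments with values in `us` compete, so the induction admits one candidate value at a
    -- time.
    restricted : ∀ us → ¬ ¬ (∃[ m ] ∀ x → f x ∈ us → f x ≤ f m)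
    restricted []       ¬∃ = ¬∃ (x₀ , λ _ ())
    restricted (u ∷ us) ¬∃ = restricted us λ (m , ub) → ¬¬-excluded-middle λ where
      (no unattained)  → ¬∃ (m , λ where
        x (here fx≡u)   → ⊥-elim (unattained (x , fx≡u))
        x (there fx∈us) → ub x fx∈us)
      (yes (y , refl)) → case ≤-total (f y) (f m) of λ where
        (inj₁ fy≤fm) → ¬∃ (m , λ where
          x (here fx≡fy)  → subst (_≤ f m) (sym fx≡fy) fy≤fm
          x (there fx∈us) → ub x fx∈us)
        (inj₂ fm≤fy) → ¬∃ (y , λ where
          x (here fx≡fy)  → ≤-reflexive fx≡fy
          x (there fx∈us) → ≤-trans (ub x fx∈us) fm≤fy)

module Throughput {a ℓ} (F : ArchimedeanOrderedField a ℓ) where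
  open ArchimedeanOrderedField F
  open Scheduling F
  open OrderedField F
  open CommutativeRing commutativeRing
    using (+-comm; +-identityˡ; +-identityʳ; -‿inverseʳ)
  open IntegerCoefficients commutativeRing using (solve; _:+_; _:-_; _:=_)
  open DecTotalOrder decTotalOrder using (poset)
    renaming (refl to ≤-refl; reflexive to ≤-reflexive; trans to ≤-trans;
              total to ≤-total)
  open Relation.Binary.Reasoning.PartialOrder poset hiding (start; stop)
  open Min totalOrder using (x⊓y≤x; x⊓y≤y; ⊓-glb)
  open Max totalOrder using (x≤x⊔y; x≤y⊔x; ⊔-lub; ⊔-monoʳ-≤)

  -- Finite sums over lists

  module _ {b} {B : Set b} where

    sum-map-mono : ∀ {f g : B → Carrier} {xs} → All (λ x → f x ≤ g x) xs →
                   sum (map f xs) ≤ sum (map g xs)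
    sum-map-mono []             = ≤-refl
    sum-map-mono (fx≤gx ∷ f≤g) = +-mono-≤ fx≤gx (sum-map-mono f≤g)

    sum-map-nonNeg : ∀ {f : B → Carrier} {xs} → All (λ x → 0# ≤ f x) xs →
                     0# ≤ sum (map f xs)
    sum-map-nonNeg []            = ≤-refl
    sum-map-nonNeg (0≤fx ∷ 0≤f) = ≤-trans 0≤fx (0≤y⇒x≤x+y (sum-map-nonNeg 0≤f))

    ∈⇒≤sum-map : ∀ {f : B → Carrier} {x xs} → All (λ x → 0# ≤ f x) xs → x ∈ xs →
                 f x ≤ sum (map f xs)
    ∈⇒≤sum-map (_ ∷ 0≤f) (here refl) = 0≤y⇒x≤x+y (sum-map-nonNeg 0≤f)
    ∈⇒≤sum-map {f} {x} {y ∷ ys} (0≤fy ∷ 0≤f) (there x∈) = begin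
      f x                      ≤⟨ ∈⇒≤sum-map 0≤f x∈ ⟩
      sum (map f ys)           ≤⟨ 0≤y⇒x≤x+y 0≤fy ⟩
      sum (map f ys) + f y     ≡⟨ +-comm _ _ ⟩
      f y + sum (map f ys)     ∎

    sum-map-+ : ∀ (f g : B → Carrier) xs →
                sum (map (λ x → f x + g x) xs) ≡ sum (map f xs) + sum (map g xs)
    sum-map-+ f g []       = sym (+-identityʳ 0#)
    sum-map-+ f g (x ∷ xs) = trans (cong (_+_ (f x + g x)) (sum-map-+ f g xs))
      (solve 4 (λ a b c d → a :+ b :+ (c :+ d) := a :+ c :+ (b :+ d)) refl (f x) (g x) _ _)

    sum-map-filter-≤ : ∀ {p} {P : B → Set p} (P? : Decidable P) {f : B → Carrier} {xs} →
                       All (λ x → 0# ≤ f x) xs →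
                       sum (map f (filter P? xs)) ≤ sum (map f xs)
    sum-map-filter-≤ P? []            = ≤-refl
    sum-map-filter-≤ P? {f} {x ∷ xs} (0≤fx ∷ 0≤f) with P? x
    ... | yes _ = +-mono-≤ ≤-refl (sum-map-filter-≤ P? 0≤f)
    ... | no _  = begin
      sum (map f (filter P? xs))   ≤⟨ sum-map-filter-≤ P? 0≤f ⟩
      sum (map f xs)               ≤⟨ 0≤y⇒x≤x+y 0≤fx ⟩
      sum (map f xs) + f x         ≡⟨ +-comm _ _ ⟩
      f x + sum (map f xs)         ∎

  -- Processing time on one machine

  totalTime : Carrier → Carrier → Schedule → Carrier
  totalTime x y S = sum (map (timeWithin x y) S)

  timeWithin-nonNeg : ∀ x y s → 0# ≤ timeWithin x y s
  timeWithin-nonNeg x y s = x≤x⊔y 0# _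

  timeWithin-mono : ∀ {x y x′ y′} s → max (start s) x′ ≤ max (start s) x →
                    min (stop s) y ≤ min (stop s) y′ →
                    timeWithin x y s ≤ timeWithin x′ y′ s
  timeWithin-mono s starts stops = ⊔-monoʳ-≤ 0# (+-mono-≤ stops (neg-mono-≤ starts))

  timeWithin-outside : ∀ x y s → min (stop s) y ≤ max (start s) x →
                       timeWithin x y s ≤ 0#
  timeWithin-outside x y s outside = ⊔-lub ≤-refl $ begin
    min (stop s) y - max (start s) x   ≤⟨ +-monoˡ-≤ _ outside ⟩
    max (start s) x - max (start s) x  ≡⟨ -‿inverseʳ _ ⟩
    0#                                 ∎

  -- Being disjoint from `s`, the segment `s′` lies wholly on one side of it. The part of the window
  -- on that side already contains all the time that `s′` spends in the window.
  timeWithin-around : ∀ x y s s′ → Disjoint s s′ →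
    timeWithin x y s′ ≤
    timeWithin x (max (start s) x) s′ + timeWithin (min (stop s) y) y s′
  timeWithin-around x y s s′ (inj₂ s′-first) = begin
    timeWithin x y s′
      ≤⟨ timeWithin-mono s′ ≤-refl earlier ⟩
    timeWithin x a′ s′
      ≤⟨ 0≤y⇒x≤x+y (timeWithin-nonNeg _ y s′) ⟩
    timeWithin x a′ s′ + timeWithin (min (stop s) y) y s′ ∎
    where
    a′ = max (start s) x
    earlier : min (stop s′) y ≤ min (stop s′) a′
    earlier = ⊓-glb (x⊓y≤x _ y)
      (≤-trans (x⊓y≤x _ y) (≤-trans s′-first (x≤x⊔y _ x)))
  timeWithin-around x y s s′ (inj₁ s-first) = begin
    timeWithin x y s′
      ≤⟨ timeWithin-mono s′ later ≤-refl ⟩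
    timeWithin b′ y s′
      ≤⟨ 0≤y⇒x≤x+y (timeWithin-nonNeg x _ s′) ⟩
    timeWithin b′ y s′ + timeWithin x (max (start s) x) s′
      ≡⟨ +-comm _ _ ⟩
    timeWithin x (max (start s) x) s′ + timeWithin b′ y s′ ∎
    where
    b′ = min (stop s) y
    later : max (start s′) b′ ≤ max (start s′) x
    later = ⊔-lub (x≤x⊔y _ x)
      (≤-trans (x⊓y≤x _ y) (≤-trans s-first (x≤x⊔y _ x)))

  -- A segment meeting [x , y] splits the rest of the schedule into the parts
  -- before and after it, so the window is generalised in the induction.

  totalTime-≤ : ∀ {S} → All (λ s → start s < stop s) S → AllPairs Disjoint S →
                ∀ {x y} → x ≤ y → totalTime x y S ≤ y - x
  totalTime-≤ [] [] x≤y = x≤y⇒0≤y-x x≤y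
  totalTime-≤ {s ∷ S} (s-nonempty ∷ nonempty) (s-disjoint ∷ disjoint) {x} {y} x≤y
    with ≤-total (stop s) x | ≤-total y (start s)
  ... | inj₁ b≤x | _ = begin
    timeWithin x y s + totalTime x y S   ≤⟨ +-mono-≤ (timeWithin-outside x y s
                                              (≤-trans (x⊓y≤x _ y) (≤-trans b≤x (x≤y⊔x _ x))))
                                              (totalTime-≤ nonempty disjoint x≤y) ⟩
    0# + (y - x)                         ≡⟨ +-identityˡ _ ⟩
    y - x                                ∎
  ... | inj₂ _ | inj₁ y≤a = begin
    timeWithin x y s + totalTime x y S   ≤⟨ +-mono-≤ (timeWithin-outside x y s
                                              (≤-trans (x⊓y≤y _ y) (≤-trans y≤a (x≤x⊔y _ x))))
                                              (totalTime-≤ nonempty disjoint x≤y) ⟩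
    0# + (y - x)                         ≡⟨ +-identityˡ _ ⟩
    y - x                                ∎
  ... | inj₂ x≤b | inj₂ a≤y = begin
    timeWithin x y s + totalTime x y S
      ≤⟨ +-mono-≤ (⊔-lub (x≤y⇒0≤y-x a′≤b′) ≤-refl)
                  (sum-map-mono (All.map (λ {s′} → timeWithin-around x y s s′) s-disjoint)) ⟩
    (b′ - a′) + sum (map (λ s′ → timeWithin x a′ s′ + timeWithin b′ y s′) S)
      ≡⟨ cong (_+_ (b′ - a′)) (sum-map-+ _ _ S) ⟩
    (b′ - a′) + (totalTime x a′ S + totalTime b′ y S)
      ≤⟨ +-mono-≤ ≤-refl (+-mono-≤ (totalTime-≤ nonempty disjoint (x≤y⊔x _ x))
                                   (totalTime-≤ nonempty disjoint (x⊓y≤y _ y))) ⟩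
    (b′ - a′) + ((a′ - x) + (y - b′))
      ≡⟨ solve 4 (λ a b x y → (b :- a) :+ ((a :- x) :+ (y :- b)) := y :- x) refl a′ b′ x y ⟩
    y - x ∎
    where
    a′ = max (start s) x
    b′ = min (stop s) y
    a′≤b′ : a′ ≤ b′
    a′≤b′ = ⊔-lub (⊓-glb (<⇒≤ s-nonempty) a≤y) (⊓-glb x≤b x≤y)

  processed-∷-same : ∀ s S {j} x y → job s ≡ j →
                     processed (s ∷ S) j x y ≡ timeWithin x y s + processed S j x y
  processed-∷-same s S x y same =
    cong (sum ∘ map (timeWithin x y)) (filter-accept (λ s → job s ≟ᴶ _) same)

  processed-∷-other : ∀ s S {j} x y → job s ≢ j →
                      processed (s ∷ S) j x y ≡ processed S j x y
  processed-∷-other s S x y other =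
    cong (sum ∘ map (timeWithin x y)) (filter-reject (λ s → job s ≟ᴶ _) other)

  module _ (x y : Carrier) where

    private
      allProcessed : Schedule → List Job → Carrier
      allProcessed S js = sum (map (λ j → processed S j x y) js)

      skip : ∀ s S {js} → All (job s ≢_) js → allProcessed (s ∷ S) js ≤ allProcessed S js
      skip s S others = sum-map-mono
        (All.map (λ ≢j → ≤-reflexive (processed-∷-other s S x y ≢j)) others)

      -- A segment works on a single job, which occurs at most once in a list without repetitions,
      -- so its time is counted at most once.
      charge : ∀ s S {js} → Unique js →
               allProcessed (s ∷ S) js ≤ timeWithin x y s + allProcessed S js
      charge s S [] = ≤-trans (timeWithin-nonNeg x y s) (0≤y⇒x≤x+y ≤-refl)
      charge s S {j ∷ js} (j∉js ∷ distinct) with job s ≟ᴶ j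
      ... | yes refl = begin
        processed (s ∷ S) j x y + allProcessed (s ∷ S) js
          ≤⟨ +-mono-≤ (≤-reflexive (processed-∷-same s S x y refl)) (skip s S j∉js) ⟩
        timeWithin x y s + processed S j x y + allProcessed S js
          ≡⟨ solve 3 (λ t p q → t :+ p :+ q := t :+ (p :+ q)) refl _ _ _ ⟩
        timeWithin x y s + (processed S j x y + allProcessed S js) ∎
      ... | no ≢j = begin
        processed (s ∷ S) j x y + allProcessed (s ∷ S) js
          ≤⟨ +-mono-≤ (≤-reflexive (processed-∷-other s S x y ≢j)) (charge s S distinct) ⟩
        processed S j x y + (timeWithin x y s + allProcessed S js)
          ≡⟨ solve 3 (λ t p q → p :+ (t :+ q) := t :+ (p :+ q)) refl _ _ _ ⟩
        timeWithin x y s + (processed S j x y + allProcessed S js) ∎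

    processed-≤-totalTime : ∀ S {js} → Unique js →
      sum (map (λ j → processed S j x y) js) ≤ totalTime x y S
    processed-≤-totalTime [] {js} _ = none js
      where
      none : ∀ js → allProcessed [] js ≤ 0#
      none []       = ≤-refl
      none (j ∷ js) = ≤-trans (+-mono-≤ ≤-refl (none js)) (≤-reflexive (+-identityʳ 0#))
    processed-≤-totalTime (s ∷ S) distinct =
      ≤-trans (charge s S distinct) (+-mono-≤ ≤-refl (processed-≤-totalTime S distinct))

  -- Serves to replace the individual release dates by a common left end of the window.
  processed-mono : ∀ S j {x x′} y → x′ ≤ x → processed S j x y ≤ processed S j x′ y
  processed-mono S j {x} {x′} y x′≤x = sum-map-mono {xs = filter (λ s → job s ≟ᴶ j) S} $
    All.universal (λ s → timeWithin-mono {x} {y} s (⊔-monoʳ-≤ (start s) x′≤x) ≤-refl) _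

  -- Existence of optimal schedules

  subsetWeights : List Job → List Carrier
  subsetWeights []       = 0# ∷ []
  subsetWeights (j ∷ js) = map (_+_ (weight j)) (subsetWeights js) ++ subsetWeights js

  -- The throughput is the weight of the subset of completed jobs. There may be infinitely many
  -- schedules, but they attain only finitely many values, as `¬¬-maximum` requires.
  throughput-∈ : ∀ js S → throughput js S ∈ subsetWeights js
  throughput-∈ []       S = here refl
  throughput-∈ (j ∷ js) S with completedOnTime? S j
  ... | yes _ = ∈-++⁺ˡ (∈-map⁺ (_+_ (weight j)) (throughput-∈ js S))
  ... | no _  = ∈-++⁺ʳ _ (throughput-∈ js S)

  emptySchedule : ∀ I → IsScheduleFor I []
  emptySchedule I = record { known = [] ; after-release = [] ; nonempty = [] ; one-machine = [] }

  -- Competitiveness speaks of optimal schedules only, so one is needed to apply it. Double negation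
  -- suffices, since it is applied in deriving a contradiction.
  ¬¬-optimal : ∀ I → ¬ ¬ (∃[ S ] IsOptimal I S)
  ¬¬-optimal I ¬optimal =
    ¬¬-maximum {X = ∃[ S ] IsScheduleFor I S}
      (throughput (jobs I) ∘ proj₁) (subsetWeights (jobs I))
      (throughput-∈ (jobs I) ∘ proj₁) ([] , emptySchedule I)
      λ ((S , isSchedule) , best) →
        ¬optimal (S , isSchedule , λ S′ isSchedule′ → best (S′ , isSchedule′))

  weight-≤-throughput : ∀ {j js} S → All (λ j → 0# < weight j) js → j ∈ js →
                        CompletedOnTime S j → weight j ≤ throughput js S
  weight-≤-throughput S 0<w j∈js done =
    ∈⇒≤sum-map (All.filter⁺ (completedOnTime? S) (All.map <⇒≤ 0<w))
      (∈-filter⁺ (completedOnTime? S) j∈js done)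

-- A growing family of instances against a fixed competitive algorithm

module Adversary {a ℓ} (F : ArchimedeanOrderedField a ℓ) where
  open ArchimedeanOrderedField F
  open Scheduling F
  open OrderedField F
  open Throughput F
  open CommutativeRing commutativeRing
    using (+-comm; +-identityʳ; -‿inverseʳ; *-identityˡ; *-identityʳ; zeroʳ)
  open IntegerCoefficients commutativeRing using (solve; _:+_; _:*_; _:-_; con; _:=_)
  open DecTotalOrder decTotalOrder using (poset)
    renaming (refl to ≤-refl; reflexive to ≤-reflexive; trans to ≤-trans)
  open Relation.Binary.Reasoning.PartialOrder poset hiding (start; stop)
  open Max totalOrder using (x≤x⊔y; x≤y⊔x; ⊔-lub)
  open Min totalOrder using (⊓-glb)
  open Multiples +-rawMonoid using () renaming (_×_ to _·_)

  module _ (δ ε : Carrier) (0<δ : 0# < δ) (δ≤ε : δ ≤ ε) (ε<1+δ : ε < 1# + δ)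
           (c : Carrier) (A : OnlineAlgorithm δ ε) (competitive : Competitive c A) where

    0<ε : 0# < ε
    0<ε = begin-strict
      0#   <⟨ 0<δ ⟩
      δ    ≤⟨ δ≤ε ⟩
      ε    ∎

    κ : Carrier
    κ = 1# + ε

    1≤κ : 1# ≤ κ
    1≤κ = 0≤y⇒x≤x+y (<⇒≤ 0<ε)

    0<κ : 0# < κ
    0<κ = pos+nonNeg 0<1 (<⇒≤ 0<ε)

    half : ∃[ h ] (0# < h × (1# + 1#) * h ≡ 1#)
    half = pos-inverse (pos+nonNeg 0<1 (<⇒≤ 0<1))

    -- ε + η lies strictly below 1 + δ, so that each job is released strictly after
    -- the last moment at which the algorithm may commit to the previous one.

    η : Carrier
    η = proj₁ half * (1# + δ - ε)

    η+η≡1+δ-ε : η + η ≡ 1# + δ - ε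
    η+η≡1+δ-ε = begin-equality
      h * v + h * v
        ≡⟨ solve 2 (λ h v → h :* v :+ h :* v := (con (+ 1) :+ con (+ 1)) :* h :* v) refl h v ⟩
      (1# + 1#) * h * v
        ≡⟨ cong (_* v) (proj₂ (proj₂ half)) ⟩
      1# * v
        ≡⟨ *-identityˡ v ⟩
      v ∎
      where
      h = proj₁ half
      v = 1# + δ - ε

    0<η : 0# < η
    0<η = *-pos (proj₁ (proj₂ half)) (x<y⇒0<y-x ε<1+δ)

    -- As `η` is half the distance from `ε` to `1# + δ`, the distance that remains is `η` again.
    ε+η<1+δ : ε + η < 1# + δ
    ε+η<1+δ = 0<y-x⇒x<y $ subst (0# <_) η≡ 0<η
      where
      η≡ : η ≡ 1# + δ - (ε + η)
      η≡ = begin-equality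
        η
          ≡⟨ solve 1 (λ η → η := η :+ η :- η) refl η ⟩
        η + η - η
          ≡⟨ cong (_- η) η+η≡1+δ-ε ⟩
        1# + δ - ε - η
          ≡⟨ solve 3 (λ u e η → u :- e :- η := u :- (e :+ η)) refl (1# + δ) ε η ⟩
        1# + δ - (ε + η) ∎

    -- From `δ ≤ ε` even `η + η ≤ 1#` follows. The bound makes the processing times non-increasing
    -- and `1# - η` non-negative.
    η≤1 : η ≤ 1#
    η≤1 = begin
      η                    ≤⟨ 0≤y⇒x≤x+y (<⇒≤ 0<η) ⟩
      η + η                ≡⟨ η+η≡1+δ-ε ⟩
      1# + δ - ε           ≤⟨ +-monoˡ-≤ (- ε) (+-mono-≤ ≤-refl δ≤ε) ⟩
      1# + ε - ε           ≡⟨ solve 1 (λ e → con (+ 1) :+ e :- e := con (+ 1)) refl ε ⟩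
      1#                   ∎

    κ-inverse : ∃[ k ] (0# < k × κ * k ≡ 1#)
    κ-inverse = pos-inverse 0<κ

    -- The ratio of consecutive processing times, obtained by solving
    -- `κ * p (suc n) ≡ (ε + η) * p n`.
    q : Carrier
    q = (ε + η) * proj₁ κ-inverse

    0<q : 0# < q
    0<q = *-pos (pos+nonNeg 0<ε (<⇒≤ 0<η)) (proj₁ (proj₂ κ-inverse))

    q≤1 : q ≤ 1#
    q≤1 = begin
      (ε + η) * k     ≤⟨ *-monoʳ-≤ (<⇒≤ (proj₁ (proj₂ κ-inverse))) (+-mono-≤ ≤-refl η≤1) ⟩
      (ε + 1#) * k    ≡⟨ solve 2 (λ e k → (e :+ con (+ 1)) :* k := (con (+ 1) :+ e) :* k) refl ε k ⟩
      κ * k           ≡⟨ proj₂ (proj₂ κ-inverse) ⟩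
      1#              ∎
      where k = proj₁ κ-inverse

    -- Processing times, release dates and weights of the jobs

    p : ℕ → Carrier
    p zero    = 1#
    p (suc n) = q * p n

    κ*p-suc : ∀ n → κ * p (suc n) ≡ (ε + η) * p n
    κ*p-suc n = begin-equality
      κ * ((ε + η) * k * p n)
        ≡⟨ solve 4 (λ κ e k p → κ :* (e :* k :* p) := κ :* k :* (e :* p)) refl κ (ε + η) k (p n) ⟩
      κ * k * ((ε + η) * p n)
        ≡⟨ cong (_* ((ε + η) * p n)) (proj₂ (proj₂ κ-inverse)) ⟩
      1# * ((ε + η) * p n)
        ≡⟨ *-identityˡ _ ⟩
      (ε + η) * p n ∎
      where k = proj₁ κ-inverse

    0<p : ∀ n → 0# < p n
    0<p zero    = 0<1
    0<p (suc n) = *-pos 0<q (0<p n)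

    -- The order `≤′` grows at its upper end, in step with the recursion of `p`.
    p-antitone′ : ∀ {m n} → m ℕ.≤′ n → p n ≤ p m
    p-antitone′ ℕ.≤′-refl               = ≤-refl
    p-antitone′ {m} (ℕ.≤′-step {n} m≤′n) = begin
      q * p n     ≤⟨ *-monoʳ-≤ (<⇒≤ (0<p n)) q≤1 ⟩
      1# * p n    ≡⟨ *-identityˡ (p n) ⟩
      p n         ≤⟨ p-antitone′ m≤′n ⟩
      p m         ∎

    p-antitone : ∀ {m n} → m ℕ.≤ n → p n ≤ p m
    p-antitone = p-antitone′ ∘ ℕₚ.≤⇒≤′

    -- Tightness forces this date: the window has length `κ * p n` and ends at `κ`. Job 0 has unit
    -- length and is released at `0#`.
    r : ℕ → Carrier
    r n = κ - κ * p n

    r-mono : ∀ {m n} → m ℕ.≤ n → r m ≤ r n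
    r-mono m≤n = +-mono-≤ ≤-refl (neg-mono-≤ (*-monoˡ-≤ (<⇒≤ 0<κ) (p-antitone m≤n)))

    0≤r : ∀ n → 0# ≤ r n
    0≤r n = begin
      0#            ≡⟨ -‿inverseʳ κ ⟨
      κ - κ         ≡⟨ cong (_-_ κ) (*-identityʳ κ) ⟨
      r zero        ≤⟨ r-mono {zero} {n} ℕ.z≤n ⟩
      r n           ∎

    -- By the recursion `r (suc n)` equals `κ - (ε + η) * p n`, so the gap is a positive multiple of
    -- `p n`. Strictness matters: at the last moment for committing to job `n`, its successor is
    -- still unknown.
    commit-before-next : ∀ n → κ - (1# + δ) * p n < r (suc n)
    commit-before-next n = 0<y-x⇒x<y $ subst (0# <_) gap≡ (*-pos (x<y⇒0<y-x ε+η<1+δ) (0<p n))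
      where
      gap≡ : (1# + δ - (ε + η)) * p n ≡ r (suc n) - (κ - (1# + δ) * p n)
      gap≡ = begin-equality
        (1# + δ - (ε + η)) * p n
          ≡⟨ solve 4 (λ d e p κ → (d :- e) :* p := κ :- e :* p :- (κ :- d :* p))
               refl (1# + δ) (ε + η) (p n) κ ⟩
        κ - (ε + η) * p n - (κ - (1# + δ) * p n)
          ≡⟨ cong (λ v → κ - v - (κ - (1# + δ) * p n)) (κ*p-suc n) ⟨
        r (suc n) - (κ - (1# + δ) * p n) ∎

    -- The ratio `c` is arbitrary and may be negative; the truncation keeps the weights positive and
    -- multiplication by the ratio monotone.
    c⁺ : Carrier
    c⁺ = max 0# c

    0≤c⁺ : 0# ≤ c⁺
    0≤c⁺ = x≤x⊔y 0# c

    -- Competitiveness bounds w n by c W n if job n is discarded, whence w.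

    W w : ℕ → Carrier
    W zero    = 0#
    W (suc n) = w n + W n
    w n       = c⁺ * W n + 1#

    0≤W : ∀ n → 0# ≤ W n
    0<w : ∀ n → 0# < w n
    0≤W zero    = ≤-refl
    0≤W (suc n) = ≤-trans (<⇒≤ (0<w n)) (0≤y⇒x≤x+y (0≤W n))
    0<w n       = subst (0# <_) (+-comm 1# _)
                    (pos+nonNeg 0<1 (*-nonNeg 0≤c⁺ (0≤W n)))

    J : ℕ → Job
    J n = mkJob n (r n) (p n) κ (w n)

    -- Contains the jobs `J 0` to `J (n - 1)`, the latest first, so that `J n` heads the list of
    -- `I (suc n)`.
    I : ℕ → Instance
    I n = record
      { jobs              = applyDownFrom J n
      ; distinct          = applyDownFrom⁺₁ J n λ j<i _ Ji≡Jj →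
          ℕₚ.<⇒≢ j<i (sym (cong label Ji≡Jj))
      ; processing-nonNeg = All.applyDownFrom⁺₂ J n (λ i → <⇒≤ (0<p i))
      ; weight-pos        = All.applyDownFrom⁺₂ J n 0<w
      }

    slack : ∀ n → HasSlack ε (I n)
    slack n = All.applyDownFrom⁺₂ J n λ i → ≤-reflexive
      (solve 2 (λ κ v → v := κ :- (κ :- v)) refl κ (κ * p i))

    totalWeight : ∀ n → sum (map weight (jobs (I n))) ≡ W n
    totalWeight zero    = refl
    totalWeight (suc n) = cong (_+_ (w n)) (totalWeight n)

    -- Commitments forced on the algorithm

    O : ℕ → Outcome
    O n = run A (I n)

    respects : ∀ n → RespectsCommitment δ (I n) (O n)
    respects n = commitments A (I n) (slack n)

    -- Bounds the optimum from below by `w n`. The job runs from its release without interruption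
    -- and ends by `κ` because `1# ≤ κ`.
    last-alone : ∀ n → ∃[ S ] (IsScheduleFor (I (suc n)) S × CompletedOnTime S (J n))
    last-alone n = s ∷ [] , isSchedule , done
      where
      s = mkSegment (J n) (r n) (r n + p n)

      p≡ : p n ≡ r n + p n - r n
      p≡ = solve 2 (λ r p → p := r :+ p :- r) refl (r n) (p n)

      isSchedule : IsScheduleFor (I (suc n)) (s ∷ [])
      isSchedule = record
        { known         = here refl ∷ []
        ; after-release = ≤-refl ∷ []
        ; nonempty      = 0<y-x⇒x<y (subst (0# <_) p≡ (0<p n)) ∷ []
        ; one-machine   = [] ∷ []
        }

      fits : r n + p n ≤ κ
      fits = begin
        r n + p n          ≡⟨ cong (_+_ (r n)) (*-identityˡ (p n)) ⟨
        r n + 1# * p n     ≤⟨ +-mono-≤ ≤-refl (*-monoʳ-≤ (<⇒≤ (0<p n)) 1≤κ) ⟩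
        r n + κ * p n      ≡⟨ solve 2 (λ κ v → κ :- v :+ v := κ) refl κ (κ * p n) ⟩
        κ                  ∎

      done : CompletedOnTime (s ∷ []) (J n)
      done = begin
        p n
          ≡⟨ p≡ ⟩
        r n + p n - r n
          ≤⟨ +-mono-≤ (⊓-glb ≤-refl fits) (neg-mono-≤ (⊔-lub ≤-refl ≤-refl)) ⟩
        min (r n + p n) κ - max (r n) (r n)
          ≤⟨ x≤y⊔x 0# _ ⟩
        timeWithin (r n) κ s
          ≡⟨ +-identityʳ _ ⟨
        timeWithin (r n) κ s + processed [] (J n) (r n) κ
          ≡⟨ processed-∷-same s [] (r n) κ refl ⟨
        processed (s ∷ []) (J n) (r n) κ ∎

    -- Without the last job, at best all the earlier ones count.
    value-discarding-last : ∀ n → commitment (O (suc n)) (J n) ≡ nothing →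
                            value (I (suc n)) (O (suc n)) ≤ W n
    value-discarding-last n discarded = begin
      throughput (filterᵇ kept (J n ∷ jobs (I n))) S
        ≡⟨ cong (λ js → throughput js S)
             (filter-reject (T? ∘ kept) (subst (T ∘ is-just) discarded)) ⟩
      throughput (filterᵇ kept (jobs (I n))) S
        ≤⟨ sum-map-filter-≤ (completedOnTime? S) (All.filter⁺ (T? ∘ kept) 0≤w) ⟩
      sum (map weight (filterᵇ kept (jobs (I n))))
        ≤⟨ sum-map-filter-≤ (T? ∘ kept) 0≤w ⟩
      sum (map weight (jobs (I n)))
        ≡⟨ totalWeight n ⟩
      W n ∎
      where
      S = schedule (O (suc n))
      kept = λ j → is-just (commitment (O (suc n)) j)
      0≤w = All.map <⇒≤ (weight-pos (I n))

    value-nonNeg : ∀ I O → 0# ≤ value I O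
    value-nonNeg I O = sum-map-nonNeg $ All.filter⁺ _ $ All.filter⁺ _ $ All.map <⇒≤ (weight-pos I)

    -- Discarding job `n` would give `w n ≤ optimum ≤ c⁺ * W n < w n`.
    commits-to-last : ∀ n → ∃[ t ] commitment (O (suc n)) (J n) ≡ just t
    commits-to-last n with commitment (O (suc n)) (J n) in decision
    ... | just t  = t , refl
    ... | nothing = ⊥-elim $ ¬¬-optimal (I (suc n)) λ (S , optimal) →
      let S₀ , isSchedule , done = last-alone n in <⇒≱ (w-large n) $ begin
        w n
          ≤⟨ weight-≤-throughput S₀ (weight-pos (I (suc n))) (here refl) done ⟩
        throughput (jobs (I (suc n))) S₀
          ≤⟨ proj₂ optimal S₀ isSchedule ⟩
        throughput (jobs (I (suc n))) S
          ≤⟨ competitive (I (suc n)) (slack (suc n)) S optimal ⟩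
        c * value (I (suc n)) (O (suc n))
          -- Passing from `c` to `c⁺` is sound because the algorithm's value is non-negative.
          ≤⟨ *-monoʳ-≤ (value-nonNeg (I (suc n)) (O (suc n))) (x≤y⊔x 0# c) ⟩
        c⁺ * value (I (suc n)) (O (suc n))
          ≤⟨ *-monoˡ-≤ 0≤c⁺ (value-discarding-last n decision) ⟩
        c⁺ * W n ∎
      where
      w-large : ∀ n → c⁺ * W n < w n
      w-large n = 0<y-x⇒x<y $ subst (0# <_)
        (solve 1 (λ v → con (+ 1) := v :+ con (+ 1) :- v) refl (c⁺ * W n)) 0<1

    -- Release dates are monotone in the index, so every job that `I m` adds to `I (suc n)` is
    -- released at `r (suc n)` or later, hence after `t`.
    same-released : ∀ {m n t} → suc n ℕ.≤ m → t < r (suc n) → SameReleasedBy t (I (suc n)) (I m)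
    same-released {m} {n} {t} n<m t<r j rj≤t = mk⇔ to from
      where
      to : j ∈ jobs (I (suc n)) → j ∈ jobs (I m)
      to j∈ with i , i<1+n , refl ← ∈-applyDownFrom⁻ J j∈ =
        ∈-applyDownFrom⁺ J (ℕₚ.<-≤-trans i<1+n n<m)

      from : j ∈ jobs (I m) → j ∈ jobs (I (suc n))
      from j∈ with i , _ , refl ← ∈-applyDownFrom⁻ J j∈ with i ℕₚ.<? suc n
      ... | yes i<1+n = ∈-applyDownFrom⁺ J i<1+n
      ... | no  i≮1+n = ⊥-elim $ <⇒≱ t<r (≤-trans (r-mono (ℕₚ.≮⇒≥ i≮1+n)) rj≤t)

    -- In `I (suc n)` the algorithm commits to job `n` before `r (suc n)`, when `I m` still looks
    -- the same. It therefore makes the same commitment in `I m`, and must honour it there.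
    completes-all : ∀ {m n} → n ℕ.< m → CompletedOnTime (schedule (O m)) (J n)
    completes-all {m} {n} n<m with t , commits ← commits-to-last n =
      let _ , _ , t≤ , _ = RespectsCommitment.committed (respects (suc n)) (J n) t commits
          t<r            = begin-strict
            t                        ≤⟨ t≤ ⟩
            κ - (1# + δ) * p n       <⟨ commit-before-next n ⟩
            r (suc n)                ∎
          _ , same = online A (I (suc n)) (I m) (slack (suc n)) (slack m) t
                       (same-released n<m t<r) t ≤-refl (J n)
          _ , _ , _ , done =
            RespectsCommitment.committed (respects m) (J n) t (Equivalence.to same commits)
      in done

    -- Committed work against the capacity of the machine

    totalProcessing : ℕ → Carrier
    totalProcessing n = sum (map processing (jobs (I n)))

    -- All jobs are completed between `0#` and `κ`, and a single machine offers no more than `κ`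
    -- units of time there.
    totalProcessing≤κ : ∀ n → totalProcessing n ≤ κ
    totalProcessing≤κ n = begin
      totalProcessing n
        ≤⟨ sum-map-mono (All.applyDownFrom⁺₁ J n λ {i} i<n →
             ≤-trans (completes-all i<n) (processed-mono S (J i) κ (0≤r i))) ⟩
      sum (map (λ j → processed S j 0# κ) (jobs (I n)))
        ≤⟨ processed-≤-totalTime 0# κ S (distinct (I n)) ⟩
      totalTime 0# κ S
        ≤⟨ totalTime-≤ nonempty one-machine (<⇒≤ 0<κ) ⟩
      κ - 0#
        ≡⟨ solve 1 (λ κ → κ :- con (+ 0) := κ) refl κ ⟩
      κ ∎
      where
      S = schedule (O n)
      open IsScheduleFor (RespectsCommitment.isSchedule (respects n))

    -- One more job raises the first summand by `(1# - η) * p n` and lowers the second by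
    -- `κ * p n - (ε + η) * p n`, which is the same amount.
    conservation : ∀ n → (1# - η) * totalProcessing n + κ * p n ≡ κ
    conservation zero    = solve 2 (λ κ v → v :* con (+ 0) :+ κ :* con (+ 1) := κ) refl κ (1# - η)
    conservation (suc n) = begin-equality
      (1# - η) * (p n + P) + κ * p (suc n)      ≡⟨ cong (_+_ ((1# - η) * (p n + P))) (κ*p-suc n) ⟩
      (1# - η) * (p n + P) + (ε + η) * p n
        ≡⟨ solve 4 (λ e η p P → let one = con (+ 1) in
             (one :- η) :* (p :+ P) :+ (e :+ η) :* p :=
             (one :- η) :* P :+ (one :+ e) :* p) refl ε η (p n) P ⟩
      (1# - η) * P + κ * p n                    ≡⟨ conservation n ⟩
      κ                                         ∎
      where P = totalProcessing n

    -- By `conservation` the difference of the two sides is `(1# - η) * (κ - P)`, a product of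
    -- non-negative factors.
    κ*p-lower : ∀ n → η * κ ≤ κ * p n
    κ*p-lower n = 0≤y-x⇒x≤y $ subst (0# ≤_) gap≡
      (*-nonNeg (x≤y⇒0≤y-x η≤1) (x≤y⇒0≤y-x (totalProcessing≤κ n)))
      where
      P = totalProcessing n
      gap≡ : (1# - η) * (κ - P) ≡ κ * p n - η * κ
      gap≡ = begin-equality
        (1# - η) * (κ - P)
          ≡⟨ solve 3 (λ η κ P → let 1-η = con (+ 1) :- η in
               1-η :* (κ :- P) := κ :- 1-η :* P :- η :* κ) refl η κ P ⟩
        κ - (1# - η) * P - η * κ
          ≡⟨ cong (λ v → v - (1# - η) * P - η * κ) (conservation n) ⟨
        (1# - η) * P + κ * p n - (1# - η) * P - η * κ
          ≡⟨ solve 3 (λ u v w → u :+ v :- u :- w := v :- w) refl ((1# - η) * P) (κ * p n) (η * κ) ⟩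
        κ * p n - η * κ ∎

    totalProcessing-lower : ∀ n → n · (η * κ) ≤ κ * totalProcessing n
    totalProcessing-lower zero    = ≤-reflexive (sym (zeroʳ κ))
    totalProcessing-lower (suc n) = begin
      η * κ + n · (η * κ)
        ≤⟨ +-mono-≤ (κ*p-lower n) (totalProcessing-lower n) ⟩
      κ * p n + κ * totalProcessing n
        ≡⟨ solve 3 (λ κ p P → κ :* p :+ κ :* P := κ :* (p :+ P)) refl κ (p n) _ ⟩
      κ * (p n + totalProcessing n) ∎

    absurd : ⊥
    -- Every multiple of `η * κ` would be at most `κ * κ`.
    absurd = multiples-unbounded (*-pos 0<η 0<κ) λ n →
      ≤-trans (totalProcessing-lower n) (*-monoˡ-≤ (<⇒≤ 0<κ) (totalProcessing≤κ n))

theorem8 : ∀ {a ℓ : Level} (F : ArchimedeanOrderedField a ℓ) →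
    let open ArchimedeanOrderedField F
        open Scheduling F
    in ∀ (δ ε : Carrier) → 0# < δ → δ ≤ ε → ε < 1# + δ →
       ¬ (∃[ c ] Σ (OnlineAlgorithm δ ε) (λ A → Competitive c A))
theorem8 F δ ε 0<δ δ≤ε ε<1+δ (c , A , competitive) =
  Adversary.absurd F δ ε 0<δ δ≤ε ε<1+δ c A competitive
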